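{- Finding a nested orientation in the dynamic-LOCAL model requires locality $\omega(1)$; that is, there is no dynamic-LOCAL algorithm that finds a nested orientation in all graphs with constant locality.
   Context: Graphs are simple, undirected, finite; $B(v,T)$ is the set of nodes within distance $T$ of $v$. Nested orientation: let $G=(V,E)$ with unique identifiers $f\colon V\to\{1,\dots,\mathrm{poly}(|V|)\}$ (part of the input). A nested orientation $(O,h)$ consists of an acyclic orientation $O$ of the edges and a labeling $h$ of the nodes with $h(v)=(f(v),F(v),H(v))$, where $F(v)=\{f(u):\{v,u\}\in E\}$ and $H(v)=\{h(u):(u,v)\in O\}$ is the set of labels of the in-neighbors of $v$ under $O$. Dynamic-LOCAL model with locality $T$: computation starts from the empty graph $G_0$; in step $i$ the adversary builds a supergraph $G_i$ of $G_{i-1}$ differing from it in exactly one node or one edge. Let $C_i$ be the set of nodes $v$ of $G_i$ with $G_i[B(v,T)]\ne G_{i-1}[B(v,T)]$. After each step the algorithm must output a feasible solution $L_i$ for $G_i$ with $L_i(v)=L_{i-1}(v)$ for all $v\notin C_i$. -}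

module Defs where

open import Data.Nat using (ℕ; zero; suc; _≤_; _^_)
open import Data.Bool using (Bool; true; false)
open import Data.List using (List; []; _∷_; length)
open import Data.List.Membership.Propositional using (_∈_; _∉_)
open import Data.Product using (_×_; _,_; ∃; ∃-syntax; Σ)
open import Data.Sum using (_⊎_)
open import Data.Unit using (⊤)
open import Data.Empty using (⊥)
open import Relation.Nullary using (¬_)
open import Relation.Binary.PropositionalEquality using (_≡_; _≢_)
open import Function.Bundles using (_⇔_)

-- Graphs.  A node is identified with its (unique) identifier f(v) ∈ ℕ.

record Graph : Set where
  constructor graph
  field
    nodes : List ℕ
    edges : List (ℕ × ℕ)   -- each undirected edge stored once, as an ordered pair
open Graph public

emptyGraph : Graph
emptyGraph = graph [] []

Adj : Graph → ℕ → ℕ → Set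
Adj G u v = ((u , v) ∈ edges G) ⊎ ((v , u) ∈ edges G)

data Within (G : Graph) : ℕ → ℕ → ℕ → Set where
  here : ∀ {k v} → v ∈ nodes G → Within G k v v
  step : ∀ {k v x w} → Within G k v x → Adj G x w → Within G (suc k) v w

SameBall : ℕ → Graph → Graph → ℕ → Set
SameBall T G G' v =
  (∀ w → Within G T v w ⇔ Within G' T v w) ×
  (∀ a b → Within G T v a → Within G T v b → (Adj G a b ⇔ Adj G' a b))

data Update : Set where
  addNode : ℕ → Update
  addEdge : ℕ → ℕ → Update

apply : Update → Graph → Graph
apply (addNode n)   G = graph (n ∷ nodes G) (edges G)
apply (addEdge u v) G = graph (nodes G) ((u , v) ∷ edges G)

-- Histories are listed newest-first: (u ∷ hs) is G_i when hs gives G_{i-1}.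
History : Set
History = List Update

build : History → Graph
build []       = emptyGraph
build (u ∷ hs) = apply u (build hs)

-- Legality of an update w.r.t. the current graph, with identifiers in
-- {1, …, |V|^c} (|V| the node count after the update) and pairwise distinct;
-- an edge joins two distinct existing nodes that are not yet adjacent.
Legal : ℕ → Update → Graph → Set
Legal c (addNode n)   G = n ∉ nodes G × 1 ≤ n × n ≤ suc (length (nodes G)) ^ c
Legal c (addEdge u v) G = u ∈ nodes G × v ∈ nodes G × u ≢ v × ¬ Adj G u v

Valid : ℕ → History → Set
Valid c []       = ⊤
Valid c (u ∷ hs) = Valid c hs × Legal c u (build hs)

-- Nested labels h(v) = (f(v), F(v), H(v)), as finite trees; the sets F and H
-- are represented by lists, compared as sets (recursively for labels).

data Label : Set where
  lab : ℕ → List ℕ → List Label → Label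

mutual
  _≈_ : Label → Label → Set
  lab a F H ≈ lab b F' H' =
    a ≡ b × (∀ x → x ∈ F ⇔ x ∈ F') × H ⊑ H' × H' ⊑ H

  _⊑_ : List Label → List Label → Set
  []      ⊑ K = ⊤
  (l ∷ H) ⊑ K = l ∈≈ K × H ⊑ K

  _∈≈_ : Label → List Label → Set
  l ∈≈ []      = ⊥
  l ∈≈ (m ∷ K) = (l ≈ m) ⊎ (l ∈≈ K)

-- Orientations: d u v ≡ true means the edge is oriented u → v, i.e. (u,v) ∈ O.

Orientation : Set
Orientation = ℕ → ℕ → Bool

data DPath (d : Orientation) : ℕ → ℕ → Set where
  one  : ∀ {u v} → d u v ≡ true → DPath d u v
  more : ∀ {u x v} → d u x ≡ true → DPath d x v → DPath d u v

IsOrientationOf : Graph → Orientation → Set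
IsOrientationOf G d =
  (∀ u v → d u v ≡ true → Adj G u v) ×
  (∀ u v → Adj G u v → (d u v ≡ true) ⊎ (d v u ≡ true)) ×
  (∀ u v → d u v ≡ true → d v u ≡ false)

Acyclic : Orientation → Set
Acyclic d = ∀ v → ¬ DPath d v v

LabelOK : Graph → Orientation → (ℕ → Label) → ℕ → Set
LabelOK G d h v =
  ∃[ F ] ∃[ H ]
    (h v ≡ lab v F H) ×
    (∀ x → x ∈ F ⇔ Adj G v x) ×
    (∀ l → l ∈ H → ∃[ u ] (d u v ≡ true × l ≈ h u)) ×
    (∀ u → d u v ≡ true → h u ∈≈ H)

Output : Set
Output = Orientation × (ℕ → Label)

NestedOrientation : Graph → Output → Set
NestedOrientation G (d , h) =
  IsOrientationOf G d × Acyclic d × (∀ v → v ∈ nodes G → LabelOK G d h v)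

-- Dynamic-LOCAL algorithms (deterministic; they see the whole history).

Algorithm : Set
Algorithm = History → Output

labelOf : Output → ℕ → Label
labelOf (d , h) = h

Stable : ℕ → Algorithm → History → Set
Stable T A []        = ⊤
Stable T A (u ∷ hs)  =
  ∀ v → v ∈ nodes (build (u ∷ hs)) →
    SameBall T (build (u ∷ hs)) (build hs) v →
    labelOf (A (u ∷ hs)) v ≈ labelOf (A hs) v

FindsNestedOrientation : ℕ → ℕ → Algorithm → Set
FindsNestedOrientation c T A =
  ∀ hs → Valid c hs → NestedOrientation (build hs) (A hs) × Stable T A hs

{-# OPTIONS --safe #-}

-- The label of v records, through its nested sets H, the neighbourhood F(u) of
-- every u from which v is reachable.  So if u reaches v at distance more than T,
-- attaching a new neighbour to u is invisible to v although its label must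
-- change.  It remains to exhibit a graph each orientation of which has such a
-- pair.  Take the shift graph: nodes are the (T+1)-sublists of a long list, and
-- x ∷ w is adjacent to w ∷ʳ z.  An orientation 2-colours the (T+2)-sublists
-- x ∷ w ∷ʳ z, so Ramsey's theorem gives 2(T+1) elements on which all shifts are
-- oriented the same way, hence a directed path between two disjoint
-- (T+1)-sublists.  These are at distance more than T because each edge replaces
-- a single element.  (Sublists of all lengths are taken as nodes; the isolated
-- node [] serves as the new neighbour.)

module Submission where

open import Defs
open import Data.Nat using (ℕ; zero; suc; pred; _+_; _^_; _≤_; _<_; z≤n; s≤s; _≟_)
open import Data.Nat.Properties using (≤-refl; ≤-reflexive; ≤-trans; m≤n⇒m≤1+n; <-irrefl; n≤1+n; m≤n⇒m<n∨m≡n; m≤m+n; m≤n+m; +-suc; +-comm; +-identityʳ; +-monoˡ-≤; +-monoʳ-≤; +-cancelˡ-≤; ≰⇒>; _≤?_; suc-injective; ^-monoʳ-≤; ^-identityʳ; module ≤-Reasoning)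
open import Data.Bool using (Bool; true; false)
open import Data.List using (List; []; _∷_; _++_; _∷ʳ_; [_]; length; map; filter; upTo; drop; cartesianProduct; initLast; _∷ʳ′_)
open import Data.List.Properties using (≡-dec; length-++; length-upTo; length-filter; filter-++; filter-all; filter-none; ∷ʳ-injectiveˡ; ++-assoc; ++-identityʳ)
open import Data.List.Membership.Propositional using (_∈_; _∉_)
open import Data.List.Membership.Propositional.Properties using (∈-++⁺ˡ; ∈-++⁺ʳ; ∈-map⁺; ∈-cartesianProduct⁺; ∈-cartesianProduct⁻)
import Data.List.Membership.DecPropositional as DecMembership
open import Data.List.Relation.Unary.Any using (here; there)
open import Data.List.Relation.Unary.All as All using ()
open import Data.List.Relation.Unary.AllPairs using ([]; _∷_)
open import Data.List.Relation.Unary.Unique.Propositional using (Unique)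
open import Data.List.Relation.Unary.Unique.Propositional.Properties using (upTo⁺)
open import Data.List.Relation.Binary.Sublist.Propositional using (_⊆_; []; _∷_; ⊆-refl; ⊆-reflexive; ⊆-trans; minimum) renaming (_∷ʳ_ to skip)
open import Data.List.Relation.Binary.Sublist.Propositional.Properties using (All-resp-⊆; ++⁺; ++⁺ˡ; ++⁺ʳ; ∷ˡ⁻)
open import Data.Product using (_×_; _,_; proj₁; proj₂; ∃; ∃₂; ∃-syntax)
open import Data.Product.Properties using () renaming (≡-dec to ×-≡-dec)
open import Data.Sum using (_⊎_; inj₁; inj₂; [_,_]′)
import Data.Sum as Sum
open import Data.Unit using (tt)
open import Data.Empty using (⊥)
open import Function using (_∘_; id; flip)
open import Function.Bundles using (_⇔_; mk⇔; module Equivalence)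
open import Function.Construct.Composition using (_⇔-∘_)
open import Function.Construct.Symmetry using (⇔-sym)
open import Relation.Nullary using (¬_; yes; no; contradiction)
open import Relation.Nullary.Decidable using (_×-dec_; _⊎-dec_; ¬?)
open import Relation.Binary.Definitions using (Decidable)
open import Relation.Binary.PropositionalEquality using (_≡_; _≢_; refl; sym; trans; cong; subst; subst₂)

open Equivalence using (from)

private
  variable
    G G′ : Graph
    d d′ : Orientation
    h h′ : ℕ → Label

-- Nested labels

≈-sym : ∀ {l m} → l ≈ m → m ≈ l
≈-sym {lab _ _ _} {lab _ _ _} (p , F , H , K) = sym p , (λ x → ⇔-sym (F x)) , K , H

mutual
  ≈-trans : ∀ {l m n} → l ≈ m → m ≈ n → l ≈ n
  ≈-trans {lab _ _ _} {lab _ _ _} {lab _ _ _} (p , F , H , H′) (q , F′ , K , K′) =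
    trans p q , (λ x → F′ x ⇔-∘ F x) , ⊑-trans H K , ⊑-trans K′ H′

  ⊑-trans : ∀ {H K L} → H ⊑ K → K ⊑ L → H ⊑ L
  ⊑-trans {[]}    _       _ = tt
  ⊑-trans {_ ∷ _} (l , H) K = ∈≈-⊑ l K , ⊑-trans H K

  ∈≈-⊑ : ∀ {l H K} → l ∈≈ H → H ⊑ K → l ∈≈ K
  ∈≈-⊑ {H = _ ∷ _} (inj₁ p) (m , _) = ≈-∈≈ p m
  ∈≈-⊑ {H = _ ∷ _} (inj₂ l) (_ , H) = ∈≈-⊑ l H

  ≈-∈≈ : ∀ {l m H} → l ≈ m → m ∈≈ H → l ∈≈ H
  ≈-∈≈ {H = _ ∷ _} p (inj₁ q) = inj₁ (≈-trans p q)
  ≈-∈≈ {H = _ ∷ _} p (inj₂ m) = inj₂ (≈-∈≈ p m)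

∈≈⇒∃ : ∀ {l H} → l ∈≈ H → ∃[ m ] (m ∈ H × l ≈ m)
∈≈⇒∃ {H = m ∷ _} (inj₁ p) = m , here refl , p
∈≈⇒∃ {H = _ ∷ _} (inj₂ q) = let m , m∈H , p = ∈≈⇒∃ q in m , there m∈H , p

≈⇒sameNode : ∀ {x y} → LabelOK G d h x → LabelOK G′ d′ h′ y → h x ≈ h′ y →
             x ≡ y × (∀ z → Adj G x z ⇔ Adj G′ y z)
≈⇒sameNode (_ , _ , hx , adj , _) (_ , _ , h′y , adj′ , _) x≈y
  with p , F , _ ← subst₂ _≈_ hx h′y x≈y
  = p , λ z → adj′ z ⇔-∘ (F z ⇔-∘ ⇔-sym (adj z))

≈⇒inNeighbour : ∀ {x v} → LabelOK G d h v → LabelOK G′ d′ h′ v → h v ≈ h′ v →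
                d x v ≡ true → ∃[ y ] (d′ y v ≡ true × h x ≈ h′ y)
≈⇒inNeighbour (_ , _ , hv , _ , _ , complete) (_ , _ , h′v , _ , sound , _) v≈v x→v
  with _ , _ , H , _ ← subst₂ _≈_ hv h′v v≈v
  with m , m∈H′ , x≈m ← ∈≈⇒∃ (∈≈-⊑ (complete _ x→v) H)
  with y , y→v , m≈y ← sound m m∈H′
  = y , y→v , ≈-trans x≈m m≈y

Closed : Graph → Set
Closed G = ∀ {u v} → Adj G u v → u ∈ nodes G × v ∈ nodes G

module _ (closed : Closed G) (closed′ : Closed G′)
         (mono : ∀ {v} → v ∈ nodes G → v ∈ nodes G′)
         (nested : NestedOrientation G (d , h)) (nested′ : NestedOrientation G′ (d′ , h′)) where

  private
    labelOK : ∀ {v} → v ∈ nodes G → LabelOK G d h v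
    labelOK = proj₂ (proj₂ nested) _

    labelOK′ : ∀ {v} → v ∈ nodes G′ → LabelOK G′ d′ h′ v
    labelOK′ = proj₂ (proj₂ nested′) _

  ≈-inNeighbour : ∀ {x v} → d x v ≡ true → h v ≈ h′ v → h x ≈ h′ x
  ≈-inNeighbour {x} x→v v≈v
    with x∈G , v∈G ← closed (proj₁ (proj₁ nested) _ _ x→v)
    with y , y→v , x≈y ← ≈⇒inNeighbour {G = G} {d = d} {h = h} {G′ = G′} {d′ = d′} {h′ = h′}
                           (labelOK v∈G) (labelOK′ (mono v∈G)) v≈v x→v
    with refl , _ ← ≈⇒sameNode {G = G} {d = d} {h = h} {G′ = G′} {d′ = d′} {h′ = h′} (labelOK x∈G)
                      (labelOK′ (proj₁ (closed′ (proj₁ (proj₁ nested′) _ _ y→v)))) x≈y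
    = x≈y

  ≈-ancestor : ∀ {u v} → DPath d u v → h v ≈ h′ v → h u ≈ h′ u
  ≈-ancestor (one u→v)    v≈v = ≈-inNeighbour u→v v≈v
  ≈-ancestor (more u→x p) v≈v = ≈-inNeighbour u→x (≈-ancestor p v≈v)

-- Locality

Within-suc : ∀ {k v w} → Within G k v w → Within G (suc k) v w
Within-suc (here v∈G) = here v∈G
Within-suc (step p e) = step (Within-suc p) e

Within-addEdge : ∀ {u w k v x} → Within G k v x → Within (apply (addEdge u w) G) k v x
Within-addEdge (here v∈G) = here v∈G
Within-addEdge (step p e) = step (Within-addEdge p) (Sum.map there there e)

Adj-addEdge⁻ : ∀ {u w a b} → Adj (apply (addEdge u w) G) a b →
               (a ≡ u ⊎ a ≡ w) ⊎ Adj G a b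
Adj-addEdge⁻ (inj₁ (here refl)) = inj₁ (inj₁ refl)
Adj-addEdge⁻ (inj₁ (there e))   = inj₂ (inj₁ e)
Adj-addEdge⁻ (inj₂ (here refl)) = inj₁ (inj₂ refl)
Adj-addEdge⁻ (inj₂ (there e))   = inj₂ (inj₂ e)

Within-addEdge⁻ : ∀ {u w v} k → ¬ Within G k v u → ¬ Within G k v w →
                  ∀ {x} → Within (apply (addEdge u w) G) k v x → Within G k v x
Within-addEdge⁻ k far-u far-w (here v∈G) = here v∈G
Within-addEdge⁻ {G} (suc k) far-u far-w (step p e)
  with q ← Within-addEdge⁻ k (far-u ∘ Within-suc) (far-w ∘ Within-suc) p
  with Adj-addEdge⁻ {G} e
... | inj₁ (inj₁ refl) = contradiction (Within-suc q) far-u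
... | inj₁ (inj₂ refl) = contradiction (Within-suc q) far-w
... | inj₂ e′          = step q e′

sameBall-addEdge : ∀ {T u w v} → ¬ Within G T v u → ¬ Within G T v w →
                   SameBall T (apply (addEdge u w) G) G v
sameBall-addEdge {G} {T} {u} {w} {v} far-u far-w =
  (λ _ → mk⇔ restrict Within-addEdge) ,
  (λ a b va _ → mk⇔ (old (restrict va)) (Sum.map there there))
  where
  restrict : ∀ {x} → Within (apply (addEdge u w) G) T v x → Within G T v x
  restrict = Within-addEdge⁻ T far-u far-w

  old : ∀ {a b} → Within G T v a → Adj (apply (addEdge u w) G) a b → Adj G a b
  old va e with Adj-addEdge⁻ {G} e
  ... | inj₁ (inj₁ refl) = contradiction va far-u
  ... | inj₁ (inj₂ refl) = contradiction va far-w
  ... | inj₂ e′          = e′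

valid⇒closed : ∀ {c} hs → Valid c hs → Closed (build hs)
valid⇒closed [] _ (inj₁ ())
valid⇒closed [] _ (inj₂ ())
valid⇒closed (addNode _ ∷ hs) (valid , _) e =
  let a , b = valid⇒closed hs valid e in there a , there b
valid⇒closed (addEdge _ _ ∷ hs) (valid , u∈ , w∈ , _) (inj₁ (here refl)) = u∈ , w∈
valid⇒closed (addEdge _ _ ∷ hs) (valid , _)           (inj₁ (there e))   = valid⇒closed hs valid (inj₁ e)
valid⇒closed (addEdge _ _ ∷ hs) (valid , u∈ , w∈ , _) (inj₂ (here refl)) = w∈ , u∈
valid⇒closed (addEdge _ _ ∷ hs) (valid , _)           (inj₂ (there e))   = valid⇒closed hs valid (inj₂ e)

descendant-notFar : ∀ {c T A} → FindsNestedOrientation c T A →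
  ∀ hs → Valid c hs → ∀ {u v w} → DPath (proj₁ (A hs)) u v →
  v ∈ nodes (build hs) → Legal c (addEdge u w) (build hs) →
  ¬ Within (build hs) T v u → ¬ Within (build hs) T v w → ⊥
descendant-notFar {A = A} finds hs valid {u} {v} {w} path v∈ legal far-u far-w =
  proj₂ (proj₂ (proj₂ legal)) (from (proj₂ sameNode w) (inj₁ (here refl)))
  where
  hs′ = addEdge u w ∷ hs
  nested = proj₁ (finds hs valid)
  nested′ = proj₁ (finds hs′ (valid , legal))

  v≈v : labelOf (A hs) v ≈ labelOf (A hs′) v
  v≈v = ≈-sym (proj₂ (finds hs′ (valid , legal)) v v∈ (sameBall-addEdge far-u far-w))

  u≈u : labelOf (A hs) u ≈ labelOf (A hs′) u
  u≈u = ≈-ancestor (valid⇒closed hs valid) (valid⇒closed hs′ (valid , legal)) id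
          nested nested′ path v≈v

  sameNode = ≈⇒sameNode {G = build hs} {d = proj₁ (A hs)} {h = labelOf (A hs)}
               {G′ = build hs′} {d′ = proj₁ (A hs′)} {h′ = labelOf (A hs′)}
               (proj₂ (proj₂ nested) u (proj₁ legal)) (proj₂ (proj₂ nested′) u (proj₁ legal)) u≈u

-- Ramsey's theorem for hypergraphs

module _ {A : Set} where

  Homogeneous : ℕ → (List A → Bool) → Bool → List A → Set
  Homogeneous k f b ys = ∀ {t} → t ⊆ ys → length t ≡ k → f t ≡ b

  -- The colour of a (1 + k)-sublist depends only on its head.
  data EndHomogeneous (k : ℕ) (f : List A → Bool) : List A → Set where
    []  : EndHomogeneous k f []
    _∷_ : ∀ {x b ys} → Homogeneous k (f ∘ (x ∷_)) b ys → EndHomogeneous k f ys →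
          EndHomogeneous k f (x ∷ ys)

  homogeneous-∷ : ∀ {k f x b ys zs} → zs ⊆ ys →
    Homogeneous k (f ∘ (x ∷_)) b ys → Homogeneous (suc k) f b zs →
    Homogeneous (suc k) f b (x ∷ zs)
  homogeneous-∷ zs⊆ys hx hzs (skip _ t⊆zs)   eq = hzs t⊆zs eq
  homogeneous-∷ zs⊆ys hx hzs (refl ∷ t⊆zs) eq = hx (⊆-trans t⊆zs zs⊆ys) (suc-injective eq)

  splitByColour : ∀ {k f ys} → EndHomogeneous k f ys →
    ∃₂ λ ts fs → ts ⊆ ys × fs ⊆ ys × length ts + length fs ≡ length ys ×
      Homogeneous (suc k) f true ts × Homogeneous (suc k) f false fs
  splitByColour [] = [] , [] , [] , [] , refl , (λ { [] () }) , (λ { [] () })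
  splitByColour (_∷_ {x} {true} hx hys)
    with ts , fs , t⊆ , f⊆ , eq , ht , hf ← splitByColour hys
    = x ∷ ts , fs , refl ∷ t⊆ , skip x f⊆ , cong suc eq , homogeneous-∷ t⊆ hx ht , hf
  splitByColour (_∷_ {x} {false} hx hys)
    with ts , fs , t⊆ , f⊆ , eq , ht , hf ← splitByColour hys
    = ts , x ∷ fs , skip x t⊆ , refl ∷ f⊆ , trans (+-suc _ _) (cong suc eq) , ht , homogeneous-∷ f⊆ hx hf

  Ramsey : ℕ → ℕ → ℕ → Set
  Ramsey k m N = ∀ f (xs : List A) → N ≤ length xs →
    ∃₂ λ ys b → ys ⊆ xs × m ≤ length ys × Homogeneous k f b ys

  EndRamsey : ℕ → ℕ → ℕ → Set
  EndRamsey k m N = ∀ f (xs : List A) → N ≤ length xs →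
    ∃ λ ys → ys ⊆ xs × m ≤ length ys × EndHomogeneous k f ys

  mutual
    ramsey : ∀ k m → ∃ (Ramsey k m)
    ramsey zero    m = m , λ f xs m≤ → xs , f [] , ⊆-refl , m≤ , λ { {[]} _ _ → refl }
    ramsey (suc k) m with endRamsey k (m + m)
    ... | N , end = N , λ f xs N≤ → pigeonhole (end f xs N≤)
      where
      pigeonhole : ∀ {f xs} → ∃ (λ ys → ys ⊆ xs × m + m ≤ length ys × EndHomogeneous k f ys) →
                   ∃₂ λ ys b → ys ⊆ xs × m ≤ length ys × Homogeneous (suc k) f b ys
      pigeonhole (ys , ys⊆ , 2m≤ , hys) with splitByColour hys
      ... | ts , fs , t⊆ , f⊆ , eq , ht , hf with m ≤? length ts
      ...   | yes m≤ = ts , true , ⊆-trans t⊆ ys⊆ , m≤ , ht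
      ...   | no m≰  = fs , false , ⊆-trans f⊆ ys⊆ ,
        +-cancelˡ-≤ m _ _ (begin
          m + m                 ≤⟨ 2m≤ ⟩
          length ys             ≡⟨ eq ⟨
          length ts + length fs ≤⟨ +-monoˡ-≤ (length fs) (≤-trans (n≤1+n _) (≰⇒> m≰)) ⟩
          m + length fs         ∎) , hf
        where open ≤-Reasoning

    endRamsey : ∀ k m → ∃ (EndRamsey k m)
    endRamsey k zero    = 0 , λ f xs _ → [] , minimum xs , z≤n , []
    endRamsey k (suc m) with M , end ← endRamsey k m with N , ram ← ramsey k M
      = suc N , extend
      where
      extend : EndRamsey k (suc m) (suc N)
      extend f (x ∷ xs) (s≤s N≤)
        with ys , b , ys⊆ , M≤ , hys ← ram (f ∘ (x ∷_)) xs N≤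
        with zs , zs⊆ , m≤ , hzs ← end f ys M≤
        = x ∷ zs , refl ∷ ⊆-trans zs⊆ ys⊆ , s≤s m≤ , (λ t⊆ → hys (⊆-trans t⊆ zs⊆)) ∷ hzs

-- Realising a finite relation as a graph

open DecMembership (×-≡-dec _≟_ _≟_) using (_∈?_)

adj? : ∀ G → Decidable (Adj G)
adj? G u v = ((u , v) ∈? edges G) ⊎-dec ((v , u) ∈? edges G)

addNodes : ℕ → History
addNodes zero    = []
addNodes (suc n) = addNode (suc n) ∷ addNodes n

∈-addNodes⁺ : ∀ {n v} → v < n → suc v ∈ nodes (build (addNodes n))
∈-addNodes⁺ {suc n} (s≤s v≤n) with m≤n⇒m<n∨m≡n v≤n
... | inj₁ v<n  = there (∈-addNodes⁺ v<n)
... | inj₂ refl = here refl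

∈-addNodes⁻ : ∀ {n v} → v ∈ nodes (build (addNodes n)) → v ≤ n
∈-addNodes⁻ {suc n} (here refl) = ≤-refl
∈-addNodes⁻ {suc n} (there v∈)  = m≤n⇒m≤1+n (∈-addNodes⁻ v∈)

length-addNodes : ∀ n → length (nodes (build (addNodes n))) ≡ n
length-addNodes zero    = refl
length-addNodes (suc n) = cong suc (length-addNodes n)

addNodes-noEdges : ∀ n → edges (build (addNodes n)) ≡ []
addNodes-noEdges zero    = refl
addNodes-noEdges (suc n) = addNodes-noEdges n

module _ {E : ℕ → ℕ → Set} (E? : Decidable E) (irrefl : ∀ {v} → ¬ E v v)
         {c : ℕ} (1≤c : 1 ≤ c) where

  addNodes-valid : ∀ n → Valid c (addNodes n)
  addNodes-valid zero    = tt
  addNodes-valid (suc n) =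
    addNodes-valid n , (λ v∈ → <-irrefl refl (∈-addNodes⁻ v∈)) , s≤s z≤n ,
    subst (λ k → suc n ≤ suc k ^ c) (sym (length-addNodes n))
      (≤-trans (≤-reflexive (sym (^-identityʳ (suc n)))) (^-monoʳ-≤ (suc n) 1≤c))

  addEdges : List (ℕ × ℕ) → History → History
  addEdges []             hs = hs
  addEdges ((u , v) ∷ ps) hs with E? u v ×-dec ¬? (adj? (build (addEdges ps hs)) u v)
  ... | yes _ = addEdge u v ∷ addEdges ps hs
  ... | no _  = addEdges ps hs

  nodes-addEdges : ∀ ps hs → nodes (build (addEdges ps hs)) ≡ nodes (build hs)
  nodes-addEdges []             hs = refl
  nodes-addEdges ((u , v) ∷ ps) hs with E? u v ×-dec ¬? (adj? (build (addEdges ps hs)) u v)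
  ... | yes _ = nodes-addEdges ps hs
  ... | no _  = nodes-addEdges ps hs

  addEdges-valid : ∀ ps hs → (∀ {u v} → (u , v) ∈ ps → u ∈ nodes (build hs) × v ∈ nodes (build hs)) →
                   Valid c hs → Valid c (addEdges ps hs)
  addEdges-valid []             hs ps⊆ valid = valid
  addEdges-valid ((u , v) ∷ ps) hs ps⊆ valid
    with ih ← addEdges-valid ps hs (ps⊆ ∘ there) valid
    with E? u v ×-dec ¬? (adj? (build (addEdges ps hs)) u v)
  ... | no _          = ih
  ... | yes (e , ¬uv) =
    ih , subst (u ∈_) eq (proj₁ (ps⊆ (here refl))) , subst (v ∈_) eq (proj₂ (ps⊆ (here refl))) ,
    (λ { refl → irrefl e }) , ¬uv
    where eq = sym (nodes-addEdges ps hs)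

  addEdges-complete : ∀ ps hs {u v} → (u , v) ∈ ps → E u v → Adj (build (addEdges ps hs)) u v
  addEdges-complete ((a , b) ∷ ps) hs uv∈ e
    with E? a b ×-dec ¬? (adj? (build (addEdges ps hs)) a b)
  addEdges-complete (_ ∷ ps) hs (here refl) e | yes _ = inj₁ (here refl)
  addEdges-complete (_ ∷ ps) hs (there uv∈) e | yes _ = Sum.map there there (addEdges-complete ps hs uv∈ e)
  addEdges-complete (_ ∷ ps) hs {u} {v} (here refl) e | no ¬p with adj? (build (addEdges ps hs)) u v
  ... | yes uv = uv
  ... | no ¬uv = contradiction (e , ¬uv) ¬p
  addEdges-complete (_ ∷ ps) hs (there uv∈) e | no _ = addEdges-complete ps hs uv∈ e

  addEdges-sound : ∀ ps hs → edges (build hs) ≡ [] →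
                   ∀ {u v} → (u , v) ∈ edges (build (addEdges ps hs)) → E u v
  addEdges-sound []             hs none uv∈ with () ← subst (_ ∈_) none uv∈
  addEdges-sound ((a , b) ∷ ps) hs none uv∈
    with E? a b ×-dec ¬? (adj? (build (addEdges ps hs)) a b)
  addEdges-sound (_ ∷ ps) hs none (here refl) | yes (e , _) = e
  addEdges-sound (_ ∷ ps) hs none (there uv∈) | yes _       = addEdges-sound ps hs none uv∈
  addEdges-sound (_ ∷ ps) hs none uv∈         | no _        = addEdges-sound ps hs none uv∈

  realise : ∀ n → ∃ λ hs → Valid c hs ×
    (∀ {v} → v < n → suc v ∈ nodes (build hs)) ×
    (∀ {u v} → u ∈ nodes (build hs) → v ∈ nodes (build hs) → E u v → Adj (build hs) u v) ×
    (∀ {u v} → Adj (build hs) u v → E u v ⊎ E v u)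
  realise n =
    addEdges ps hs ,
    addEdges-valid ps hs (∈-cartesianProduct⁻ vs vs) (addNodes-valid n) ,
    subst (_ ∈_) (sym same) ∘ ∈-addNodes⁺ ,
    (λ u∈ v∈ → addEdges-complete ps hs
      (∈-cartesianProduct⁺ (subst (_ ∈_) same u∈) (subst (_ ∈_) same v∈))) ,
    Sum.map (addEdges-sound ps hs (addNodes-noEdges n)) (addEdges-sound ps hs (addNodes-noEdges n))
    where
    hs = addNodes n
    vs = nodes (build hs)
    ps = cartesianProduct vs vs
    same = nodes-addEdges ps hs

-- The shift graph

sublists : ∀ {A : Set} → List A → List (List A)
sublists []       = [ [] ]
sublists (x ∷ xs) = map (x ∷_) (sublists xs) ++ sublists xs

∈-sublists⁺ : ∀ {A : Set} {t xs : List A} → t ⊆ xs → t ∈ sublists xs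
∈-sublists⁺ []                        = here refl
∈-sublists⁺ {xs = x ∷ xs} (skip _ t⊆) = ∈-++⁺ʳ (map (x ∷_) (sublists xs)) (∈-sublists⁺ t⊆)
∈-sublists⁺ {xs = x ∷ xs} (refl ∷ t⊆) = ∈-++⁺ˡ (∈-map⁺ (x ∷_) (∈-sublists⁺ t⊆))

unique-⊆ : ∀ {A : Set} {xs ys : List A} → xs ⊆ ys → Unique ys → Unique xs
unique-⊆ []         []          = []
unique-⊆ (skip _ τ) (_ ∷ uniq)  = unique-⊆ τ uniq
unique-⊆ (refl ∷ τ) (y∉ ∷ uniq) = All-resp-⊆ τ y∉ ∷ unique-⊆ τ uniq

unique-++⇒disjoint : ∀ {A : Set} (xs : List A) {ys x} → Unique (xs ++ ys) → x ∈ xs → x ∉ ys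
unique-++⇒disjoint (x ∷ xs) (x∉ ∷ _)   (here refl) x∈ys = All.lookup x∉ (∈-++⁺ʳ xs x∈ys) refl
unique-++⇒disjoint (x ∷ xs) (_ ∷ uniq) (there x∈)  x∈ys = unique-++⇒disjoint xs uniq x∈ x∈ys

splitAt-≤ : ∀ {A : Set} m n (xs : List A) → m + n ≤ length xs →
            ∃₂ λ ys zs → ys ++ zs ⊆ xs × length ys ≡ m × length zs ≡ n
splitAt-≤ zero    zero    xs       _       = [] , [] , minimum xs , refl , refl
splitAt-≤ zero    (suc n) (x ∷ xs) (s≤s p)
  with [] , zs , τ , refl , refl ← splitAt-≤ zero n xs p = [] , x ∷ zs , refl ∷ τ , refl , refl
splitAt-≤ (suc m) n       (x ∷ xs) (s≤s p)
  with ys , zs , τ , refl , refl ← splitAt-≤ m n xs p = x ∷ ys , zs , refl ∷ τ , refl , refl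

Shift : List ℕ → List ℕ → Set
Shift []      t = ⊥
Shift (x ∷ w) t = ∃[ z ] t ≡ w ∷ʳ z

shift? : Decidable Shift
shift? []      t = no λ ()
shift? (x ∷ w) t with initLast t
... | []     = no λ { (_ , eq) → []≢∷ʳ w eq }
  where
  []≢∷ʳ : ∀ (w : List ℕ) {z} → [] ≢ w ∷ʳ z
  []≢∷ʳ []      ()
  []≢∷ʳ (_ ∷ _) ()
... | t′ ∷ʳ′ z with ≡-dec _≟_ t′ w
...   | yes refl = yes (z , refl)
...   | no t′≢w  = no λ { (_ , eq) → t′≢w (∷ʳ-injectiveˡ t′ w eq) }

open DecMembership _≟_ using () renaming (_∈?_ to _∈ℕ?_)

common : List ℕ → List ℕ → ℕ
common S t = length (filter (_∈ℕ? S) t)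

common-++ : ∀ S s t → common S (s ++ t) ≡ common S s + common S t
common-++ S s t = trans (cong length (filter-++ (_∈ℕ? S) s t)) (length-++ (filter (_∈ℕ? S) s))

common-self : ∀ S → common S S ≡ length S
common-self S = cong length (filter-all (_∈ℕ? S) (All.tabulate id))

common-disjoint : ∀ {S t} → (∀ {x} → x ∈ t → x ∉ S) → common S t ≡ 0
common-disjoint {S} t∉S = cong length (filter-none (_∈ℕ? S) (All.tabulate t∉S))

common-shift : ∀ S {s t} → Shift s t →
                common S s ≤ suc (common S t) × common S t ≤ suc (common S s)
common-shift S {x ∷ w} (z , refl)
  rewrite common-++ S [ x ] w | common-++ S w [ z ] =
  (begin
    common S [ x ] + common S w       ≤⟨ +-monoˡ-≤ _ (length-filter (_∈ℕ? S) [ x ]) ⟩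
    suc (common S w)                   ≤⟨ s≤s (m≤m+n _ _) ⟩
    suc (common S w + common S [ z ]) ∎) ,
  (begin
    common S w + common S [ z ]       ≤⟨ +-monoʳ-≤ _ (length-filter (_∈ℕ? S) [ z ]) ⟩
    common S w + 1                     ≡⟨ +-comm _ 1 ⟩
    suc (common S w)                   ≤⟨ s≤s (m≤n+m _ _) ⟩
    suc (common S [ x ] + common S w) ∎)
  where open ≤-Reasoning

nth : List (List ℕ) → ℕ → List ℕ
nth []      _       = []
nth (t ∷ L) zero    = t
nth (t ∷ L) (suc i) = nth L i

position : List (List ℕ) → List ℕ → ℕ
position []      t = 0
position (s ∷ L) t with ≡-dec _≟_ s t
... | yes _ = 0
... | no _  = suc (position L t)

position-∈ : ∀ {L t} → t ∈ L → position L t < length L × nth L (position L t) ≡ t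
position-∈ {s ∷ L} {t} t∈ with ≡-dec _≟_ s t
position-∈ t∈          | yes s≡t = s≤s z≤n , s≡t
position-∈ (here refl) | no s≢t  = contradiction refl s≢t
position-∈ (there t∈)  | no _    = let p , q = position-∈ t∈ in s≤s p , q

module _ (L : List (List ℕ)) where

  -- Identifiers start at 1, hence the offset.
  decode : ℕ → List ℕ
  decode n = nth L (pred n)

  code : List ℕ → ℕ
  code t = suc (position L t)

  ShiftEdge : ℕ → ℕ → Set
  ShiftEdge u v = Shift (decode u) (decode v) × u ≢ v

  shiftEdge? : Decidable ShiftEdge
  shiftEdge? u v = shift? (decode u) (decode v) ×-dec ¬? (u ≟ v)

  within⇒common : (∀ {u v} → Adj G u v → ShiftEdge u v ⊎ ShiftEdge v u) →
    ∀ S {k a b} → Within G k a b → common S (decode a) ≤ k + common S (decode b)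
  within⇒common sound S (here _) = m≤n+m _ _
  within⇒common sound S {suc k} {a} {b} (step {x = x} p e) = begin
    common S (decode a)           ≤⟨ within⇒common sound S p ⟩
    k + common S (decode x)       ≤⟨ +-monoʳ-≤ k ([ proj₁ ∘ common-shift S ∘ proj₁ , proj₂ ∘ common-shift S ∘ proj₁ ]′ (sound e)) ⟩
    k + suc (common S (decode b)) ≡⟨ +-suc k _ ⟩
    suc k + common S (decode b)   ∎
    where open ≤-Reasoning

-- Directed paths along shifts

DPath-∷ʳ : ∀ {u x v} → DPath d u x → d x v ≡ true → DPath d u v
DPath-∷ʳ (one u→x)    x→v = more u→x (one x→v)
DPath-∷ʳ (more u→y p) x→v = more u→y (DPath-∷ʳ p x→v)

DPath-flip : ∀ {u v} → DPath (flip d) u v → DPath d v u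
DPath-flip (one e)    = one e
DPath-flip (more e p) = DPath-∷ʳ (DPath-flip p) e

init : List ℕ → List ℕ
init []           = []
init (x ∷ [])     = []
init (x ∷ y ∷ ys) = x ∷ init (y ∷ ys)

init-∷ʳ : ∀ w z → init (w ∷ʳ z) ≡ w
init-∷ʳ []          z = refl
init-∷ʳ (x ∷ [])    z = refl
init-∷ʳ (x ∷ y ∷ w) z = cong (x ∷_) (init-∷ʳ (y ∷ w) z)

ShiftOriented : Orientation → (List ℕ → ℕ) → ℕ → List ℕ → Set
ShiftOriented d code r ys = ∀ {x w z} → (x ∷ w) ∷ʳ z ⊆ ys → length (x ∷ w) ≡ r →
                            d (code (x ∷ w)) (code (w ∷ʳ z)) ≡ true

shiftPath : ∀ {code r ys} → ShiftOriented d code r ys →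
  ∀ x a b zs → length (x ∷ a) ≡ length zs → (x ∷ a ++ b) ++ zs ⊆ ys → length (x ∷ a ++ b) ≡ r →
  DPath d (code (x ∷ a ++ b)) (code (b ++ zs))
shiftPath or x [] b (z ∷ []) _ τ len = one (or τ len)
shiftPath {d} {code} {r} {ys} or x (y ∷ a) b (z ∷ zs) eq τ len =
  more (subst (λ s → d (code (x ∷ y ∷ a ++ b)) (code s) ≡ true) assoc₁
         (or (⊆-trans (++⁺ (⊆-refl {x = x ∷ y ∷ a ++ b}) (refl ∷ minimum zs)) τ) len))
       (subst (λ s → DPath d (code (y ∷ a ++ (b ∷ʳ z))) (code s)) (++-assoc b [ z ] zs)
         (shiftPath {code = code} or y a (b ∷ʳ z) zs (suc-injective eq)
           (⊆-trans (⊆-reflexive assoc₂) (∷ˡ⁻ τ))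
           (trans (trans (cong length (sym assoc₁)) (trans (length-++ (y ∷ a ++ b)) (+-comm _ 1))) len)))
  where
  assoc₁ : (y ∷ a ++ b) ∷ʳ z ≡ y ∷ a ++ (b ∷ʳ z)
  assoc₁ = ++-assoc (y ∷ a) b [ z ]

  assoc₂ : (y ∷ a ++ (b ∷ʳ z)) ++ zs ≡ (y ∷ a ++ b) ++ z ∷ zs
  assoc₂ = trans (cong (_++ zs) (sym assoc₁)) (++-assoc (y ∷ a ++ b) [ z ] zs)

theoremB3 : (c : ℕ) → 1 ≤ c → (T : ℕ) → (A : Algorithm) →
    ¬ FindsNestedOrientation c T A
theoremB3 c 1≤c T A finds
  with N , ram ← ramsey {ℕ} (suc (suc T)) (suc T + suc T)
  with hs , valid , isNode , complete , sound ←
         realise (shiftEdge? (sublists (upTo N))) (λ e → proj₂ e refl) 1≤c (length (sublists (upTo N)))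
  with ys , b , ys⊆ , 2r≤ , hom ←
         ram (λ t → proj₁ (A hs) (code (sublists (upTo N)) (init t)) (code (sublists (upTo N)) (drop 1 t)))
           (upTo N) (≤-reflexive (sym (length-upTo N)))
  with x ∷ s , t , st⊆ , s-len , t-len ← splitAt-≤ (suc T) (suc T) ys 2r≤
  = conclude b hom
  where
  L = sublists (upTo N)
  H = build hs
  O = proj₁ (A hs)

  ⟦_⟧ : List ℕ → ℕ
  ⟦_⟧ = code L

  decode-code : ∀ {t} → t ⊆ upTo N → decode L ⟦ t ⟧ ≡ t
  decode-code τ = proj₂ (position-∈ (∈-sublists⁺ τ))

  code-node : ∀ {t} → t ⊆ upTo N → ⟦ t ⟧ ∈ nodes H
  code-node τ = isNode (proj₁ (position-∈ (∈-sublists⁺ τ)))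

  code-injective : ∀ {s t} → s ⊆ upTo N → t ⊆ upTo N → ⟦ s ⟧ ≡ ⟦ t ⟧ → s ≡ t
  code-injective σ τ eq = trans (sym (decode-code σ)) (trans (cong (decode L) eq) (decode-code τ))

  shift-adj : ∀ {x w z} → (x ∷ w) ∷ʳ z ⊆ upTo N → Adj H ⟦ x ∷ w ⟧ ⟦ w ∷ʳ z ⟧
  shift-adj {x} {w} {z} τ = complete (code-node σ) (code-node σ′)
    (subst₂ Shift (sym (decode-code σ)) (sym (decode-code σ′)) (z , refl) , distinct)
    where
    σ : x ∷ w ⊆ upTo N
    σ = ⊆-trans (++⁺ʳ [ z ] ⊆-refl) τ

    σ′ : w ∷ʳ z ⊆ upTo N
    σ′ = ∷ˡ⁻ τ

    distinct : ⟦ x ∷ w ⟧ ≢ ⟦ w ∷ʳ z ⟧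
    distinct eq with x∉ ∷ _ ← unique-⊆ τ (upTo⁺ N)
      = All.lookup x∉ (subst (x ∈_) (code-injective σ σ′ eq) (here refl)) refl

  []-isolated : ∀ {u} → ¬ Adj H u ⟦ [] ⟧
  []-isolated {u} e with sound e
  ... | inj₁ (sh , _) = ¬shift-[] (subst (Shift (decode L u)) (decode-code (minimum _)) sh)
    where
    ¬shift-[] : ∀ {s} → ¬ Shift s []
    ¬shift-[] {_ ∷ []}    (_ , ())
    ¬shift-[] {_ ∷ _ ∷ _} (_ , ())
  ... | inj₂ (sh , _) = subst (λ s → Shift s (decode L u)) (decode-code (minimum _)) sh

  noPath : ∀ {s t} → s ⊆ upTo N → t ⊆ upTo N → length s ≡ suc T → length t ≡ suc T →
           (∀ {x} → x ∈ s → x ∉ t) → ¬ DPath O ⟦ s ⟧ ⟦ t ⟧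
  noPath {s} {t} σ τ s-len t-len disjoint path =
    descendant-notFar finds hs valid path (code-node τ)
      (code-node σ , code-node (minimum _) , code≢ σ s-len , []-isolated) far-s far-[]
    where
    code≢ : ∀ {t} → t ⊆ upTo N → length t ≡ suc T → ⟦ t ⟧ ≢ ⟦ [] ⟧
    code≢ τ len eq with refl ← code-injective τ (minimum _) eq with () ← len

    far-s : ¬ Within H T ⟦ t ⟧ ⟦ s ⟧
    far-s p = <-irrefl refl (begin-strict
      T                               <⟨ ≤-refl ⟩
      suc T                           ≡⟨ t-len ⟨
      length t                        ≡⟨ common-self t ⟨
      common t t                     ≡⟨ cong (common t) (decode-code τ) ⟨
      common t (decode L ⟦ t ⟧)      ≤⟨ within⇒common L sound t p ⟩
      T + common t (decode L ⟦ s ⟧)  ≡⟨ cong (λ s → T + common t s) (decode-code σ) ⟩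
      T + common t s                 ≡⟨ cong (T +_) (common-disjoint disjoint) ⟩
      T + 0                           ≡⟨ +-identityʳ T ⟩
      T                               ∎)
      where open ≤-Reasoning

    far-[] : ¬ Within H T ⟦ t ⟧ ⟦ [] ⟧
    far-[] p = go p refl refl
      where
      go : ∀ {k v w} → Within H k v w → v ≡ ⟦ t ⟧ → w ≢ ⟦ [] ⟧
      go (here _)   refl eq   = code≢ τ t-len eq
      go (step _ e) _    refl = []-isolated e

  disjoint : ∀ {y} → y ∈ x ∷ s → y ∉ t
  disjoint = unique-++⇒disjoint (x ∷ s) (unique-⊆ (⊆-trans st⊆ ys⊆) (upTo⁺ N))

  s⊆ : x ∷ s ⊆ upTo N
  s⊆ = ⊆-trans (++⁺ʳ t ⊆-refl) (⊆-trans st⊆ ys⊆)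

  t⊆ : t ⊆ upTo N
  t⊆ = ⊆-trans (++⁺ˡ (x ∷ s) ⊆-refl) (⊆-trans st⊆ ys⊆)

  path : ∀ {d} → ShiftOriented d ⟦_⟧ (suc T) ys → DPath d ⟦ x ∷ s ⟧ ⟦ t ⟧
  path {d} or = subst (λ w → DPath d ⟦ w ⟧ ⟦ t ⟧) (++-identityʳ (x ∷ s))
    (shiftPath or x s [] t (trans s-len (sym t-len))
      (subst (λ w → w ++ t ⊆ ys) (sym (++-identityʳ (x ∷ s))) st⊆)
      (trans (cong length (++-identityʳ (x ∷ s))) s-len))

  colour : ∀ {b x w z} →
    Homogeneous (suc (suc T)) (λ t → O ⟦ init t ⟧ ⟦ drop 1 t ⟧) b ys →
    (x ∷ w) ∷ʳ z ⊆ ys → length (x ∷ w) ≡ suc T → O ⟦ x ∷ w ⟧ ⟦ w ∷ʳ z ⟧ ≡ b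
  colour {b} {x} {w} {z} hom τ len =
    subst (λ s → O ⟦ s ⟧ ⟦ w ∷ʳ z ⟧ ≡ b) (init-∷ʳ (x ∷ w) z)
      (hom τ (trans (length-++ (x ∷ w)) (trans (+-comm _ 1) (cong suc len))))

  conclude : ∀ b → Homogeneous (suc (suc T)) (λ t → O ⟦ init t ⟧ ⟦ drop 1 t ⟧) b ys → ⊥
  conclude true  hom = noPath s⊆ t⊆ s-len t-len disjoint (path (colour hom))
  conclude false hom = noPath t⊆ s⊆ t-len s-len (λ y∈t y∈s → disjoint y∈s y∈t) (DPath-flip (path reversed))
    where
    reversed : ShiftOriented (flip O) ⟦_⟧ (suc T) ys
    reversed τ len with proj₁ (proj₂ (proj₁ (proj₁ (finds hs valid)))) _ _ (shift-adj (⊆-trans τ ys⊆))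
    ... | inj₂ e = e
    ... | inj₁ e with () ← trans (sym e) (colour hom τ len)
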